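{- Let $G$ and $H$ be finite graphs with $\chi(G) > 2$, let $\phi : H \rightarrow G$ be a graph homomorphism, and let $r \in \mathbb{N}$ be such that $|\phi(N(v))| \leq r$ for every $v \in V(H)$. Then $\chi(H) \leq \lceil r\, 2^r \log\log \chi(G) \rceil$.
   Context: Graphs are simple (no loops). For a vertex $v$, $N(v)$ is the set of neighbours of $v$ (excluding $v$), and for a set $X$ of vertices, $\phi(X) = \{\phi(x) : x \in X\}$. A graph homomorphism $\phi: H \to G$ is a map $V(H) \to V(G)$ sending edges to edges. $\chi$ denotes the chromatic number and $\log$ is the base-2 logarithm. -}

module Defs where

open import Data.Nat using (ℕ; zero; suc; _+_; _*_; _∸_; _^_; _≤_; _<_)
open import Data.Fin using (Fin)
open import Data.Fin.Properties using (any?)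
open import Data.Fin.Subset using (Subset; inside; outside)
open import Data.Vec using (tabulate)
open import Data.Product using (Σ; ∃; _×_; _,_)
open import Data.Sum using (_⊎_)
open import Relation.Nullary using (¬_; Dec)
open import Relation.Nullary.Decidable using (⌊_⌋)
open import Relation.Nullary.Decidable using (_×-dec_)
open import Relation.Binary.PropositionalEquality using (_≡_; _≢_)
open import Data.Fin using () renaming (_≟_ to _≟F_)
open import Data.Bool using (if_then_else_)

record Graph : Set₁ where
  field
    n     : ℕ
    Adj   : Fin n → Fin n → Set
    adj?  : ∀ u v → Dec (Adj u v)
    sym   : ∀ {u v} → Adj u v → Adj v u
    irrefl : ∀ {u} → ¬ Adj u u
open Graph public

V : Graph → Set
V G = Fin (n G)

IsHom : (H G : Graph) → (V H → V G) → Set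
IsHom H G φ = ∀ u v → Adj H u v → Adj G (φ u) (φ v)

Colourable : Graph → ℕ → Set
Colourable G k = Σ (V G → Fin k) λ f → ∀ u v → Adj G u v → f u ≢ f v

IsChromaticNumber : Graph → ℕ → Set
IsChromaticNumber G c = Colourable G c × (∀ k → Colourable G k → c ≤ k)

imageNbhd : (H G : Graph) → (V H → V G) → V H → Subset (n G)
imageNbhd H G φ v =
  tabulate λ w → if ⌊ any? (λ u → adj? H v u ×-dec (φ u ≟F w)) ⌋ then inside else outside

-- LtMulLogLog j m c  ⇔  (j : ℝ) < m · log₂ (log₂ c)   (c ≥ 1, m ≥ 1),
-- expressed via a rational a/b strictly between 2^(j/m) and log₂ c:
--   2^(j/m) < a/b  ⇔  2^j · b^m < a^m ,   a/b < log₂ c  ⇔  2^a < c^b.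
LtMulLogLog : ℕ → ℕ → ℕ → Set
LtMulLogLog j m c =
  ∃ λ a → ∃ λ b → 0 < b × (2 ^ j) * (b ^ m) < a ^ m × 2 ^ a < c ^ b

-- k ≤ ⌈ r · 2^r · log₂ log₂ c ⌉   (for integer k: k = 0, or k - 1 < r 2^r log log c)
LeCeilBound : ℕ → ℕ → ℕ → Set
LeCeilBound k r c = k ≡ 0 ⊎ LtMulLogLog (k ∸ 1) (r * 2 ^ r) c

{-# OPTIONS --safe #-}

-- Colour G by words of L bits, where 2 ^ L ≥ c, and give each vertex v of H the partial word that
-- records the word of φ v at the positions where it first differs from the word of a neighbour of
-- φ v in φ(N(v)); at most r positions are recorded. If k words of length L are such that every
-- partial word with r recorded bits extends to one of them, then H is k-colourable: adjacent
-- vertices record opposite bits at a common position. A word extending at least a 2 ^ -r fraction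
-- of the remaining partial words always exists, so the greedy choice succeeds once
-- 2 ^ r (L choose r) (1 - 2 ^ -r) ^ k < 1. With 2 ^ a < c ≤ 2 ^ (a + 1) and L = a + 1 this holds
-- already for k = ⌈ r 2 ^ r log a ⌉, provided 3 ≤ a and 2 ≤ r ≤ a + 1. For r = 1 the two constant
-- words suffice; for r ≥ 2, if c ≤ 8 or r > a + 1, then c itself is within the bound and the
-- colouring of G pulls back along φ.
module Submission where

open import Defs
open import Data.Bool using (Bool; true; false; _∨_; _xor_; T; if_then_else_)
open import Data.Bool.Properties using (T?)
open import Data.Fin using (Fin; zero; suc; inject≤; finToFun; funToFin; combine)
  renaming (_≟_ to _≟ᶠ_)
open import Data.Fin.Properties
  using (any?; 2↔Bool; funToFin-finToFin; inject≤-injective)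
open import Data.Fin.Subset
  using (Subset; inside; outside; _∈_; _∪_; ⁅_⁆; ∣_∣; ⊥)
open import Data.Fin.Subset.Properties
  using (∣p∣≤n; x∈⁅x⁆; x∈p⇒∣p-x∣<∣p∣; ∣⁅x⁆∣≡1; ∣⊥∣≡0; p⊆p∪q; q⊆p∪q; nonempty?)
open import Data.List using (List; []; _∷_; _++_; map; filter; length)
open import Data.List.Membership.Propositional using () renaming (_∈_ to _∈ˡ_)
open import Data.List.Membership.Propositional.Properties
  using (∈-map⁺; ∈-++⁺ˡ; ∈-++⁺ʳ; ∈-filter⁺)
open import Data.List.Properties using (length-++; length-map)
open import Data.List.Relation.Unary.All as All using (All; []; _∷_)
open import Data.List.Relation.Unary.All.Properties using (++⁺; map⁺; filter⁺)
open import Data.List.Relation.Unary.Any using (here)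
open import Data.Maybe using (Maybe; just; nothing)
open import Data.Nat
  using (ℕ; zero; suc; _+_; _*_; _^_; _≤_; _<_; z≤n; s≤s; s≤s⁻¹; z<s; NonZero; >-nonZero; _≤?_)
open import Data.Nat.Properties
open import Data.Nat.Tactic.RingSolver using (solve-∀)
open import Data.Product using (∃; _×_; _,_; proj₁; proj₂; ∃-syntax; Σ-syntax)
open import Data.Sum using (_⊎_; inj₁; inj₂)
open import Data.Unit using (tt)
open import Data.Vec using (Vec; []; _∷_; lookup; tabulate; replicate)
  renaming (here to hereᵛ; there to thereᵛ)
open import Data.Vec.Properties using (lookup∘tabulate; lookup⇒[]=; lookup-replicate)
open import Function using (_∘_)
open import Function.Bundles using (Inverse; Injection)
open import Function.Properties.Inverse using (↔⇒↣)
open import Relation.Nullary using (Dec; ¬_; yes; no; contradiction)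
open import Relation.Nullary.Decidable using (_×-dec_; dec-true; isYes≗does)
open import Relation.Binary.PropositionalEquality
  using (_≡_; _≢_; refl; trans; cong; cong₂; subst; subst₂; module ≡-Reasoning)
  renaming (sym to ≡-sym)

-- Universal sets of words

-- An (L, r)-universal set in the sense of derandomization. The pattern prescribed on `P` is given
-- as the restriction of a total word `x`, so partial functions are avoided here.
Universal : ℕ → ℕ → ℕ → Set
Universal r L k = Σ[ g ∈ (Fin k → Vec Bool L) ]
  (∀ (P : Subset L) (x : Vec Bool L) → ∣ P ∣ ≤ r →
    ∃[ i ] ∀ {j} → j ∈ P → lookup (g i) j ≡ lookup x j)

-- Sizes and images of finite subsets

∣p∪q∣≤∣p∣+∣q∣ : ∀ {m} (p q : Subset m) → ∣ p ∪ q ∣ ≤ ∣ p ∣ + ∣ q ∣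
∣p∪q∣≤∣p∣+∣q∣ []            []            = z≤n
∣p∪q∣≤∣p∣+∣q∣ (outside ∷ p) (outside ∷ q) = ∣p∪q∣≤∣p∣+∣q∣ p q
∣p∪q∣≤∣p∣+∣q∣ (outside ∷ p) (inside ∷ q)  =
  ≤-trans (s≤s (∣p∪q∣≤∣p∣+∣q∣ p q)) (≤-reflexive (≡-sym (+-suc ∣ p ∣ ∣ q ∣)))
∣p∪q∣≤∣p∣+∣q∣ (inside ∷ p)  (outside ∷ q) = s≤s (∣p∪q∣≤∣p∣+∣q∣ p q)
∣p∪q∣≤∣p∣+∣q∣ (inside ∷ p)  (inside ∷ q)  =
  s≤s (≤-trans (∣p∪q∣≤∣p∣+∣q∣ p q) (+-monoʳ-≤ ∣ p ∣ (n≤1+n ∣ q ∣)))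

image : ∀ {m l} → (Fin m → Fin l) → Subset m → Subset l
image f []            = ⊥
image f (outside ∷ p) = image (f ∘ suc) p
image f (inside ∷ p)  = ⁅ f zero ⁆ ∪ image (f ∘ suc) p

∣image∣≤ : ∀ {m l} (f : Fin m → Fin l) (p : Subset m) → ∣ image f p ∣ ≤ ∣ p ∣
∣image∣≤ {l = l} f [] = ≤-reflexive (∣⊥∣≡0 l)
∣image∣≤ f (outside ∷ p) = ∣image∣≤ (f ∘ suc) p
∣image∣≤ f (inside ∷ p)  = begin
  ∣ ⁅ f zero ⁆ ∪ image (f ∘ suc) p ∣        ≤⟨ ∣p∪q∣≤∣p∣+∣q∣ ⁅ f zero ⁆ _ ⟩
  ∣ ⁅ f zero ⁆ ∣ + ∣ image (f ∘ suc) p ∣    ≡⟨ cong (_+ ∣ image (f ∘ suc) p ∣) (∣⁅x⁆∣≡1 (f zero)) ⟩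
  suc ∣ image (f ∘ suc) p ∣                 ≤⟨ s≤s (∣image∣≤ (f ∘ suc) p) ⟩
  suc ∣ p ∣                                 ∎
  where open ≤-Reasoning

∈-image : ∀ {m l} (f : Fin m → Fin l) {p : Subset m} {x} → x ∈ p → f x ∈ image f p
∈-image f {inside ∷ p}  hereᵛ       = p⊆p∪q _ (x∈⁅x⁆ (f zero))
∈-image f {outside ∷ p} (thereᵛ x∈p) = ∈-image (f ∘ suc) x∈p
∈-image f {inside ∷ p}  (thereᵛ x∈p) =
  q⊆p∪q ⁅ f zero ⁆ _ (∈-image (f ∘ suc) x∈p)

∣p∣≤1⇒x≡y : ∀ {m} {p : Subset m} → ∣ p ∣ ≤ 1 → ∀ {x y} → x ∈ p → y ∈ p → x ≡ y
∣p∣≤1⇒x≡y _ hereᵛ hereᵛ = refl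
∣p∣≤1⇒x≡y {p = inside ∷ p} h hereᵛ (thereᵛ y∈p) =
  contradiction (<-≤-trans (x∈p⇒∣p-x∣<∣p∣ y∈p) (s≤s⁻¹ h)) λ ()
∣p∣≤1⇒x≡y {p = inside ∷ p} h (thereᵛ x∈p) _ =
  contradiction (<-≤-trans (x∈p⇒∣p-x∣<∣p∣ x∈p) (s≤s⁻¹ h)) λ ()
∣p∣≤1⇒x≡y {p = outside ∷ p} h (thereᵛ x∈p) (thereᵛ y∈p) =
  cong suc (∣p∣≤1⇒x≡y h x∈p y∈p)

-- First differences and binary encodings

-- For equal words this is the last position.
firstDiff : ∀ {L} → Vec Bool (suc L) → Vec Bool (suc L) → Fin (suc L)
firstDiff {zero}  _       _       = zero
firstDiff {suc L} (a ∷ x) (b ∷ y) = if a xor b then zero else suc (firstDiff x y)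

firstDiff-comm : ∀ {L} (x y : Vec Bool (suc L)) → firstDiff x y ≡ firstDiff y x
firstDiff-comm {zero}  _           _           = refl
firstDiff-comm {suc L} (true ∷ x)  (true ∷ y)  = cong suc (firstDiff-comm x y)
firstDiff-comm {suc L} (true ∷ x)  (false ∷ y) = refl
firstDiff-comm {suc L} (false ∷ x) (true ∷ y)  = refl
firstDiff-comm {suc L} (false ∷ x) (false ∷ y) = cong suc (firstDiff-comm x y)

-- A genuine difference would contradict the agreement, so the position is the default last one,
-- reached only when all earlier bits coincide.
lookup-firstDiff : ∀ {L} (x y : Vec Bool (suc L)) →
  lookup x (firstDiff x y) ≡ lookup y (firstDiff x y) → x ≡ y
lookup-firstDiff {zero}  (a ∷ [])    (b ∷ [])    eq = cong (_∷ []) eq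
lookup-firstDiff {suc L} (true ∷ x)  (true ∷ y)  eq = cong (true ∷_) (lookup-firstDiff x y eq)
lookup-firstDiff {suc L} (false ∷ x) (false ∷ y) eq = cong (false ∷_) (lookup-firstDiff x y eq)

funToFin-cong : ∀ {m l} {f g : Fin m → Fin l} → (∀ i → f i ≡ g i) → funToFin f ≡ funToFin g
funToFin-cong {zero}  f≗g = refl
funToFin-cong {suc m} f≗g = cong₂ combine (f≗g zero) (funToFin-cong (f≗g ∘ suc))

binary : ∀ {c L} → c ≤ 2 ^ L → Fin c → Vec Bool L
binary c≤2^L i = tabulate (Inverse.to 2↔Bool ∘ finToFun (inject≤ i c≤2^L))

binary-injective : ∀ {c L} (c≤2^L : c ≤ 2 ^ L) {i j : Fin c} →
  binary c≤2^L i ≡ binary c≤2^L j → i ≡ j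
binary-injective {c} {L} c≤2^L {i} {j} eq = inject≤-injective c≤2^L c≤2^L i j (begin
  i′                     ≡⟨ funToFin-finToFin {L} i′ ⟨
  funToFin {L} {2} (finToFun i′) ≡⟨ funToFin-cong digit ⟩
  funToFin {L} {2} (finToFun j′) ≡⟨ funToFin-finToFin {L} j′ ⟩
  j′                     ∎)
  where
  open ≡-Reasoning
  i′ = inject≤ i c≤2^L
  j′ = inject≤ j c≤2^L
  digit : ∀ d → finToFun {2} {L} i′ d ≡ finToFun j′ d
  digit d = Injection.injective (↔⇒↣ 2↔Bool) (begin
    Inverse.to 2↔Bool (finToFun i′ d)  ≡⟨ lookup∘tabulate _ d ⟨
    lookup (binary c≤2^L i) d          ≡⟨ cong (λ x → lookup x d) eq ⟩
    lookup (binary c≤2^L j) d          ≡⟨ lookup∘tabulate _ d ⟩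
    Inverse.to 2↔Bool (finToFun j′ d)  ∎)

-- Colouring `H` from a universal set

∈-imageNbhd : ∀ (H G : Graph) (φ : V H → V G) {v u} → Adj H v u → φ u ∈ imageNbhd H G φ v
∈-imageNbhd H G φ {v} {u} vu = lookup⇒[]= (φ u) (imageNbhd H G φ v) (trans
  (lookup∘tabulate _ (φ u))
  (cong (if_then inside else outside)
    (trans (isYes≗does adjacent?) (dec-true adjacent? (u , vu , refl)))))
  where
  adjacent? = any? λ u′ → adj? H v u′ ×-dec (φ u′ ≟ᶠ φ u)

-- A vertex is coloured by the index of a word that follows the word of its image at all recorded
-- positions. Both ends of an edge record the position where their words first differ, so a common
-- index would make these words agree there.
universal⇒colourable : ∀ {G H : Graph} (φ : V H → V G) → IsHom H G φ →
  ∀ {r} → (∀ v → ∣ imageNbhd H G φ v ∣ ≤ r) →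
  ∀ {c L k} → Colourable G c → c ≤ 2 ^ suc L → Universal r (suc L) k → Colourable H k
universal⇒colourable {G} {H} φ hom {r} deg {c} {L} {k} (ψ , proper) c≤2^L (g , universal) =
  (λ v → proj₁ (chosen v)) , colours-differ
  where
  word : V G → Vec Bool (suc L)
  word w = binary c≤2^L (ψ w)

  differences : V H → Subset (suc L)
  differences v = image (λ w → firstDiff (word (φ v)) (word w)) (imageNbhd H G φ v)

  chosen : ∀ v → ∃[ i ] ∀ {j} → j ∈ differences v → lookup (g i) j ≡ lookup (word (φ v)) j
  chosen v = universal (differences v) (word (φ v)) (≤-trans (∣image∣≤ _ (imageNbhd H G φ v)) (deg v))

  agrees : ∀ u v → Adj H u v →
    let d = firstDiff (word (φ u)) (word (φ v)) in
    lookup (g (proj₁ (chosen u))) d ≡ lookup (word (φ u)) d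
  agrees u v uv = proj₂ (chosen u)
    (∈-image (λ w → firstDiff (word (φ u)) (word w)) (∈-imageNbhd H G φ uv))

  colours-differ : ∀ u v → Adj H u v → proj₁ (chosen u) ≢ proj₁ (chosen v)
  colours-differ u v uv same = proper (φ u) (φ v) (hom u v uv)
    (binary-injective c≤2^L (lookup-firstDiff (word (φ u)) (word (φ v)) (begin
      lookup (word (φ u)) d            ≡⟨ agrees u v uv ⟨
      lookup (g (proj₁ (chosen u))) d  ≡⟨ cong (λ i → lookup (g i) d) same ⟩
      lookup (g (proj₁ (chosen v))) d
        -- The vertex `v` records the first difference with the arguments swapped; symmetry of
        -- `firstDiff` makes it the position `d` recorded by `u`.
        ≡⟨ subst (λ e → lookup (g (proj₁ (chosen v))) e ≡ lookup (word (φ v)) e)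
             (firstDiff-comm (word (φ v)) (word (φ u)))
             (agrees v u (Graph.sym H uv)) ⟩
      lookup (word (φ v)) d            ∎)))
    where
    open ≡-Reasoning
    d = firstDiff (word (φ u)) (word (φ v))

-- The case r = 1

universal-1 : ∀ L → Universal 1 L 2
universal-1 L = g , agree
  where
  g : Fin 2 → Vec Bool L
  g i = replicate L (Inverse.to 2↔Bool i)

  agree : (P : Subset L) (x : Vec Bool L) → ∣ P ∣ ≤ 1 →
    ∃[ i ] ∀ {j} → j ∈ P → lookup (g i) j ≡ lookup x j
  agree P x ∣P∣≤1 with nonempty? P
  ... | no  P-empty   = zero , λ j∈P → contradiction (_ , j∈P) P-empty
  ... | yes (p , p∈P) = Inverse.from 2↔Bool (lookup x p) , λ {j} j∈P → begin
    lookup (g (Inverse.from 2↔Bool (lookup x p))) j   ≡⟨ lookup-replicate j _ ⟩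
    Inverse.to 2↔Bool (Inverse.from 2↔Bool (lookup x p)) ≡⟨ Inverse.strictlyInverseˡ 2↔Bool _ ⟩
    lookup x p                                       ≡⟨ cong (lookup x) (∣p∣≤1⇒x≡y ∣P∣≤1 p∈P j∈P) ⟩
    lookup x j                                       ∎
    where open ≡-Reasoning

-- Sums and averages over the cube

cubeSum : ∀ {L} → (Vec Bool L → ℕ) → ℕ
cubeSum {zero}  f = f []
cubeSum {suc L} f = cubeSum (f ∘ (true ∷_)) + cubeSum (f ∘ (false ∷_))

cubeSum-const : ∀ L a → cubeSum {L} (λ _ → a) ≡ 2 ^ L * a
cubeSum-const zero    a = ≡-sym (+-identityʳ a)
cubeSum-const (suc L) a rewrite cubeSum-const L a = double (2 ^ L) a
  where
  double : ∀ m a → m * a + m * a ≡ (m + (m + 0)) * a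
  double = solve-∀

cubeSum-cong : ∀ {L} {f g : Vec Bool L → ℕ} → (∀ x → f x ≡ g x) → cubeSum f ≡ cubeSum g
cubeSum-cong {zero}  f≗g = f≗g []
cubeSum-cong {suc L} f≗g = cong₂ _+_ (cubeSum-cong (f≗g ∘ (true ∷_))) (cubeSum-cong (f≗g ∘ (false ∷_)))

cubeSum-+ : ∀ {L} (f g : Vec Bool L → ℕ) → cubeSum (λ x → f x + g x) ≡ cubeSum f + cubeSum g
cubeSum-+ {zero}  f g = refl
cubeSum-+ {suc L} f g
  rewrite cubeSum-+ (f ∘ (true ∷_)) (g ∘ (true ∷_))
        | cubeSum-+ (f ∘ (false ∷_)) (g ∘ (false ∷_)) =
  interchange (cubeSum (f ∘ (true ∷_))) (cubeSum (g ∘ (true ∷_)))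
              (cubeSum (f ∘ (false ∷_))) (cubeSum (g ∘ (false ∷_)))
  where
  interchange : ∀ a b c d → a + b + (c + d) ≡ a + c + (b + d)
  interchange = solve-∀

2*m*a≡m*a+m*a : ∀ m a → 2 * m * a ≡ m * a + m * a
2*m*a≡m*a+m*a = solve-∀

-- The method of conditional expectations: fix the bits one by one, each time keeping the half of
-- the cube with the smaller sum.
below-average : ∀ {L} (f : Vec Bool L → ℕ) → ∃[ x ] 2 ^ L * f x ≤ cubeSum f
below-average {zero}  f = [] , ≤-reflexive (*-identityˡ (f []))
below-average {suc L} f with ≤-total (cubeSum (f ∘ (true ∷_))) (cubeSum (f ∘ (false ∷_)))
... | inj₁ true≤false with below-average (f ∘ (true ∷_))
...   | x , bound = true ∷ x , ≤-trans
  (≤-reflexive (2*m*a≡m*a+m*a (2 ^ L) (f (true ∷ x))))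
  (+-mono-≤ bound (≤-trans bound true≤false))
below-average {suc L} f | inj₂ false≤true with below-average (f ∘ (false ∷_))
...   | x , bound = false ∷ x , ≤-trans
  (≤-reflexive (2*m*a≡m*a+m*a (2 ^ L) (f (false ∷ x))))
  (+-mono-≤ (≤-trans bound false≤true) bound)

-- Partial words and the density of words missing them

-- nothing marks an unconstrained position.
Partial : ℕ → Set
Partial L = Vec (Maybe Bool) L

misses : ∀ {L} → Partial L → Vec Bool L → Bool
misses []            []      = false
misses (nothing ∷ t) (b ∷ x) = misses t x
misses (just a ∷ t)  (b ∷ x) = (a xor b) ∨ misses t x

missCount : ∀ {L} → List (Partial L) → Vec Bool L → ℕ
missCount ts x = length (filter (λ t → T? (misses t x)) ts)

-- The partial words with exactly r constrained positions.
partials : ∀ L → ℕ → List (Partial L)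
partials zero    zero    = [] ∷ []
partials zero    (suc r) = []
partials (suc L) zero    = map (nothing ∷_) (partials L zero)
partials (suc L) (suc r) =
  map (nothing ∷_) (partials L (suc r)) ++
  map (just true ∷_) (partials L r) ++ map (just false ∷_) (partials L r)

indicator : Bool → ℕ
indicator b = if b then 1 else 0

-- A proportion 1 - 2 ^ -r of all words miss t, stated without subtraction.
MissDensity : ℕ → ∀ {L} → Partial L → Set
MissDensity r {L} t = cubeSum (indicator ∘ misses t) * 2 ^ r + 2 ^ L ≡ 2 ^ L * 2 ^ r

density-nothing : ∀ r {L} (t : Partial L) → MissDensity r t → MissDensity r (nothing ∷ t)
density-nothing r {L} t eq =
  trans (lhs (cubeSum (indicator ∘ misses t)) (2 ^ r) (2 ^ L))
    (trans (cong₂ _+_ eq eq) (rhs (2 ^ L) (2 ^ r)))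
  where
  lhs : ∀ s p l → (s + s) * p + (l + (l + 0)) ≡ (s * p + l) + (s * p + l)
  lhs = solve-∀
  rhs : ∀ l p → l * p + l * p ≡ (l + (l + 0)) * p
  rhs = solve-∀

-- In the half of the cube with the wrong first bit every word misses; the other half behaves as for
-- `t`. The proportion of hits is therefore halved.
density-just : ∀ r {L} a (t : Partial L) → MissDensity r t → MissDensity (suc r) (just a ∷ t)
density-just r {L} a t eq = trans (cong (λ s → s * 2 ^ suc r + 2 ^ suc L) (half a))
  (trans (lhs (cubeSum (indicator ∘ misses t)) (2 ^ r) (2 ^ L))
    (trans (cong (λ q → 2 * q + 2 * (2 ^ L * 2 ^ r)) eq) (rhs (2 ^ L) (2 ^ r))))
  where
  half : ∀ a → cubeSum (indicator ∘ misses (just a ∷ t)) ≡ cubeSum (indicator ∘ misses t) + 2 ^ L * 1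
  half true  = cong (cubeSum (indicator ∘ misses t) +_) (cubeSum-const L 1)
  half false = trans (cong (_+ cubeSum (indicator ∘ misses t)) (cubeSum-const L 1))
    (+-comm (2 ^ L * 1) _)
  lhs : ∀ s p l → (s + l * 1) * (p + (p + 0)) + (l + (l + 0)) ≡ 2 * (s * p + l) + 2 * (l * p)
  lhs = solve-∀
  rhs : ∀ l p → 2 * (l * p) + 2 * (l * p) ≡ (l + (l + 0)) * (p + (p + 0))
  rhs = solve-∀

partials-density : ∀ L r → All (MissDensity r) (partials L r)
partials-density zero    zero    = refl ∷ []
partials-density zero    (suc r) = []
partials-density (suc L) zero    = map⁺ (All.map (λ {t} → density-nothing zero t) (partials-density L zero))
partials-density (suc L) (suc r) =
  ++⁺ (map⁺ (All.map (λ {t} → density-nothing (suc r) t) (partials-density L (suc r))))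
    (++⁺ (map⁺ (All.map (λ {t} → density-just r true t) (partials-density L r)))
         (map⁺ (All.map (λ {t} → density-just r false t) (partials-density L r))))

missCount-∷ : ∀ {L} (t : Partial L) ts x →
  missCount (t ∷ ts) x ≡ indicator (misses t x) + missCount ts x
missCount-∷ t ts x with misses t x
... | false = refl
... | true  = refl

-- Double counting of the pairs of a partial word in `ts` and a word missing it: the density
-- equations are added up over `ts`.
cubeSum-missCount : ∀ r {L} {ts : List (Partial L)} → All (MissDensity r) ts →
  cubeSum (missCount ts) * 2 ^ r + 2 ^ L * length ts ≡ 2 ^ L * length ts * 2 ^ r
cubeSum-missCount r {L} [] =
  trans (cong (λ s → s * 2 ^ r + 2 ^ L * 0) (cubeSum-const L 0)) (vanish (2 ^ L) (2 ^ r))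
  where
  vanish : ∀ l p → l * 0 * p + l * 0 ≡ l * 0 * p
  vanish = solve-∀
cubeSum-missCount r {L} {t ∷ ts} (d ∷ ds) = begin
  cubeSum (missCount (t ∷ ts)) * 2 ^ r + 2 ^ L * suc (length ts)
    ≡⟨ cong (λ s → s * 2 ^ r + 2 ^ L * suc (length ts))
         (trans (cubeSum-cong (missCount-∷ t ts))
           (cubeSum-+ (indicator ∘ misses t) (missCount ts))) ⟩
  (cubeSum (indicator ∘ misses t) + cubeSum (missCount ts)) * 2 ^ r + 2 ^ L * suc (length ts)
    ≡⟨ lhs (cubeSum (indicator ∘ misses t)) (cubeSum (missCount ts)) (2 ^ r) (2 ^ L) (length ts) ⟩
  (cubeSum (indicator ∘ misses t) * 2 ^ r + 2 ^ L) + (cubeSum (missCount ts) * 2 ^ r + 2 ^ L * length ts)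
    ≡⟨ cong₂ _+_ d (cubeSum-missCount r ds) ⟩
  2 ^ L * 2 ^ r + 2 ^ L * length ts * 2 ^ r
    ≡⟨ rhs (2 ^ L) (2 ^ r) (length ts) ⟩
  2 ^ L * suc (length ts) * 2 ^ r ∎
  where
  open ≡-Reasoning
  lhs : ∀ s s′ p l n → (s + s′) * p + l * suc n ≡ (s * p + l) + (s′ * p + l * n)
  lhs = solve-∀
  rhs : ∀ l p n → l * p + l * n * p ≡ l * suc n * p
  rhs = solve-∀

-- Greedy choice of words

-- Here `e` is 2 ^ r - 1, so each partial word is missed by the fraction e / suc e of all words, and
-- a word that is no worse than average is taken.
few-missed : ∀ r e {L} {ts : List (Partial L)} → 2 ^ r ≡ suc e → All (MissDensity r) ts →
  ∃[ x ] missCount ts x * suc e ≤ length ts * e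
few-missed r e {L} {ts} D≡ dense with below-average (missCount ts)
... | x , bound = x , *-cancelˡ-≤ (2 ^ L) {{m^n≢0 2 L}} (+-cancelʳ-≤ (2 ^ L * length ts) _ _ (begin
  2 ^ L * (missCount ts x * suc e) + 2 ^ L * length ts
    ≡⟨ cong (_+ 2 ^ L * length ts) (≡-sym (*-assoc (2 ^ L) (missCount ts x) (suc e))) ⟩
  2 ^ L * missCount ts x * suc e + 2 ^ L * length ts
    ≤⟨ +-monoˡ-≤ (2 ^ L * length ts) (*-monoˡ-≤ (suc e) bound) ⟩
  cubeSum (missCount ts) * suc e + 2 ^ L * length ts
    ≡⟨ subst (λ D → cubeSum (missCount ts) * D + 2 ^ L * length ts ≡ 2 ^ L * length ts * D) D≡
         (cubeSum-missCount r dense) ⟩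
  2 ^ L * length ts * suc e
    ≡⟨ split (2 ^ L) (length ts) e ⟩
  2 ^ L * (length ts * e) + 2 ^ L * length ts ∎))
  where
  open ≤-Reasoning
  split : ∀ l n e → l * n * suc e ≡ l * (n * e) + l * n
  split = solve-∀

-- Each round leaves at most the fraction e / suc e of the list, which uses up one factor on each
-- side of the last hypothesis. With no rounds left, that hypothesis says that the list has fewer
-- than one entry.
greedy : ∀ r e k {L} (ts : List (Partial L)) → 2 ^ r ≡ suc e → All (MissDensity r) ts →
  length ts * e ^ k < suc e ^ k →
  Σ[ g ∈ Vec (Vec Bool L) k ] (∀ {t} → t ∈ˡ ts → ∃[ i ] ¬ T (misses t (lookup g i)))
greedy r e zero []       D≡ dense small = [] , λ ()
greedy r e zero (t ∷ ts) D≡ dense (s≤s ())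
greedy r e (suc k) ts D≡ dense small with few-missed r e D≡ dense
... | x , bound with greedy r e k (filter (λ t → T? (misses t x)) ts) D≡ (filter⁺ _ dense)
                       (*-cancelˡ-< (suc e) _ _ (begin-strict
  suc e * (missCount ts x * e ^ k) ≡⟨ swap (suc e) (missCount ts x) (e ^ k) ⟩
  missCount ts x * suc e * e ^ k   ≤⟨ *-monoˡ-≤ (e ^ k) bound ⟩
  length ts * e * e ^ k            ≡⟨ *-assoc (length ts) e (e ^ k) ⟩
  length ts * (e * e ^ k)          <⟨ small ⟩
  suc e * suc e ^ k                ∎))
  where
  open ≤-Reasoning
  swap : ∀ d m p → d * (m * p) ≡ m * d * p
  swap = solve-∀
...   | g , hit = x ∷ g , covered
  where
  covered : ∀ {t} → t ∈ˡ ts → ∃[ i ] ¬ T (misses t (lookup (x ∷ g) i))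
  covered {t} t∈ts with T? (misses t x)
  ... | no  hits   = zero , hits
  ... | yes missed with hit (∈-filter⁺ (λ t → T? (misses t x)) t∈ts missed)
  ...   | i , hits = suc i , hits

-- From hitting all partial words to universality

misses-just : ∀ {L} a b (t : Partial L) x → ¬ T (misses (just a ∷ t) (b ∷ x)) → b ≡ a × ¬ T (misses t x)
misses-just true  true  t x hits = refl , hits
misses-just true  false t x hits = contradiction _ hits
misses-just false true  t x hits = contradiction _ hits
misses-just false false t x hits = refl , hits

∈-partials-just : ∀ {L} r b {t : Partial L} → t ∈ˡ partials L r → just b ∷ t ∈ˡ partials (suc L) (suc r)
∈-partials-just {L} r true  t∈ =
  ∈-++⁺ʳ (map (nothing ∷_) (partials L (suc r))) (∈-++⁺ˡ (∈-map⁺ (just true ∷_) t∈))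
∈-partials-just {L} r false t∈ = ∈-++⁺ʳ (map (nothing ∷_) (partials L (suc r)))
  (∈-++⁺ʳ (map (just true ∷_) (partials L r)) (∈-map⁺ (just false ∷_) t∈))

∈-partials-nothing : ∀ {L} r {t : Partial L} → t ∈ˡ partials L r → nothing ∷ t ∈ˡ partials (suc L) r
∈-partials-nothing zero    t∈ = ∈-map⁺ (nothing ∷_) t∈
∈-partials-nothing (suc r) t∈ = ∈-++⁺ˡ (∈-map⁺ (nothing ∷_) t∈)

-- Entries of `partials L r` constrain exactly `r` positions, so a smaller `P` is padded with
-- further bits of `x`; r ≤ L leaves room for this.
restriction-extends : ∀ {L} r (P : Subset L) (x : Vec Bool L) → ∣ P ∣ ≤ r → r ≤ L →
  ∃[ t ] t ∈ˡ partials L r ×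
    (∀ y → ¬ T (misses t y) → ∀ {j} → j ∈ P → lookup y j ≡ lookup x j)
restriction-extends zero    []            []      _         _ = [] , here refl , λ { _ _ () }
restriction-extends (suc r) (inside ∷ P)  (b ∷ x) (s≤s P≤r) (s≤s r≤L)
  with restriction-extends r P x P≤r r≤L
... | t , t∈ , agree = just b ∷ t , ∈-partials-just r b t∈ , λ
  { (a ∷ y) hits hereᵛ        → proj₁ (misses-just b a t y hits)
  ; (a ∷ y) hits (thereᵛ j∈P) → agree y (proj₂ (misses-just b a t y hits)) j∈P }
restriction-extends {suc L} r (outside ∷ P) (b ∷ x) P≤r r≤1+L with r ≤? L
... | yes r≤L with restriction-extends r P x P≤r r≤L
...   | t , t∈ , agree = nothing ∷ t , ∈-partials-nothing r t∈ , λ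
  { (a ∷ y) hits (thereᵛ j∈P) → agree y hits j∈P }
restriction-extends {suc L} zero (outside ∷ P) (b ∷ x) P≤r r≤1+L | no r≰L = contradiction z≤n r≰L
-- As many bits remain to be constrained as there are positions, so this one is constrained although
-- it lies outside the given subset.
restriction-extends {suc L} (suc r) (outside ∷ P) (b ∷ x) P≤r (s≤s r≤L) | no r≰L
  with restriction-extends r P x (≤-trans (∣p∣≤n P) (s≤s⁻¹ (≰⇒> r≰L))) r≤L
... | t , t∈ , agree = just b ∷ t , ∈-partials-just r b t∈ , λ
  { (a ∷ y) hits (thereᵛ j∈P) → agree y (proj₂ (misses-just b a t y hits)) j∈P }

universal-greedy : ∀ r e k L → 2 ^ r ≡ suc e → r ≤ L →
  length (partials L r) * e ^ k < suc e ^ k → Universal r L k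
universal-greedy r e k L D≡ r≤L small = lookup (proj₁ family) , agree
  where
  family = greedy r e k (partials L r) D≡ (partials-density L r) small

  agree : (P : Subset L) (x : Vec Bool L) → ∣ P ∣ ≤ r →
    ∃[ i ] ∀ {j} → j ∈ P → lookup (lookup (proj₁ family) i) j ≡ lookup x j
  agree P x P≤r with restriction-extends r P x P≤r r≤L
  ... | t , t∈ , extends with proj₂ family t∈
  ...   | i , hits = i , extends _ hits

-- Counting partial words

-- Equal to 2 ^ r times the binomial coefficient (L choose r).
count : ℕ → ℕ → ℕ
count L r = length (partials L r)

count-zero : ∀ L → count L 0 ≡ 1
count-zero zero    = refl
count-zero (suc L) = trans (length-map _ (partials L 0)) (count-zero L)

count-suc : ∀ L r → count (suc L) (suc r) ≡ count L (suc r) + (count L r + count L r)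
count-suc L r = trans (length-++ (map _ (partials L (suc r))))
  (cong₂ _+_ (length-map _ (partials L (suc r)))
    (trans (length-++ (map _ (partials L r)))
      (cong₂ _+_ (length-map _ (partials L r)) (length-map _ (partials L r)))))

-- The absorption identity for binomial coefficients, with a factor 2 for the extra bit. It follows
-- by induction from the Pascal rule `count-suc`.
count-absorption : ∀ L r → suc r * count (suc L) (suc r) ≡ 2 * suc L * count L r
count-absorption zero zero = refl
count-absorption zero (suc r) = *-zeroʳ r
count-absorption (suc L) zero = begin
  1 * count (2 + L) 1                            ≡⟨ cong (1 *_) (count-suc (suc L) 0) ⟩
  1 * (count (suc L) 1 + (count (suc L) 0 + count (suc L) 0))
    ≡⟨ split (count (suc L) 1) (count (suc L) 0) ⟩
  1 * count (suc L) 1 + 2 * count (suc L) 0      ≡⟨ cong (_+ 2 * count (suc L) 0) (count-absorption L 0) ⟩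
  2 * suc L * count L 0 + 2 * count (suc L) 0
    ≡⟨ cong₂ (λ p q → 2 * suc L * p + 2 * q) (count-zero L) (count-zero (suc L)) ⟩
  2 * suc L * 1 + 2 * 1                          ≡⟨ collect L ⟩
  2 * suc (suc L) * 1                            ≡⟨ cong (2 * suc (suc L) *_) (count-zero (suc L)) ⟨
  2 * suc (suc L) * count (suc L) 0              ∎
  where
  open ≡-Reasoning
  split : ∀ p q → 1 * (p + (q + q)) ≡ 1 * p + 2 * q
  split = solve-∀
  collect : ∀ L → 2 * suc L * 1 + 2 * 1 ≡ 2 * suc (suc L) * 1
  collect = solve-∀
count-absorption (suc L) (suc r) = begin
  suc (suc r) * count (2 + L) (2 + r)
    ≡⟨ cong (suc (suc r) *_) (count-suc (suc L) (suc r)) ⟩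
  suc (suc r) * (P + (Q + Q))                           ≡⟨ split r P Q ⟩
  suc (suc r) * P + 2 * (suc r * Q) + 2 * Q
    ≡⟨ cong₂ (λ p q → p + 2 * q + 2 * Q) (count-absorption L (suc r)) (count-absorption L r) ⟩
  2 * suc L * count L (suc r) + 2 * (2 * suc L * count L r) + 2 * Q
    ≡⟨ collect L (count L (suc r)) (count L r) Q ⟩
  2 * suc L * (count L (suc r) + (count L r + count L r)) + 2 * Q
    ≡⟨ cong (λ q → 2 * suc L * q + 2 * Q) (count-suc L r) ⟨
  2 * suc L * Q + 2 * Q                                 ≡⟨ factor L Q ⟩
  2 * suc (suc L) * Q                                   ∎
  where
  open ≡-Reasoning
  P = count (suc L) (2 + r)
  Q = count (suc L) (suc r)
  split : ∀ r p q → suc (suc r) * (p + (q + q)) ≡ suc (suc r) * p + 2 * (suc r * q) + 2 * q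
  split = solve-∀
  collect : ∀ L p q s → 2 * suc L * p + 2 * (2 * suc L * q) + 2 * s ≡ 2 * suc L * (p + (q + q)) + 2 * s
  collect = solve-∀
  factor : ∀ L q → 2 * suc L * q + 2 * q ≡ 2 * suc (suc L) * q
  factor = solve-∀

count-mono : ∀ L r → count L r ≤ count (suc L) r
count-mono L zero    = ≤-reflexive (trans (count-zero L) (≡-sym (count-zero (suc L))))
count-mono L (suc r) = ≤-trans (m≤m+n _ _) (≤-reflexive (≡-sym (count-suc L r)))

count-2 : ∀ L → count (2 + L) 2 ≡ 2 * ((2 + L) * (1 + L))
count-2 L = *-cancelˡ-≡ _ _ 2 (begin
  2 * count (2 + L) 2                       ≡⟨ count-absorption (suc L) 1 ⟩
  2 * (2 + L) * count (1 + L) 1             ≡⟨ cong (2 * (2 + L) *_) (*-identityˡ (count (1 + L) 1)) ⟨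
  2 * (2 + L) * (1 * count (1 + L) 1)       ≡⟨ cong (2 * (2 + L) *_) (count-absorption L 0) ⟩
  2 * (2 + L) * (2 * (1 + L) * count L 0)   ≡⟨ cong (λ q → 2 * (2 + L) * (2 * (1 + L) * q)) (count-zero L) ⟩
  2 * (2 + L) * (2 * (1 + L) * 1)           ≡⟨ collect L ⟩
  2 * (2 * ((2 + L) * (1 + L)))             ∎)
  where
  open ≡-Reasoning
  collect : ∀ L → 2 * (2 + L) * (2 * (1 + L) * 1) ≡ 2 * (2 * ((2 + L) * (1 + L)))
  collect = solve-∀

count-3 : ∀ L → 3 * count (3 + L) 3 ≡ 4 * ((3 + L) * ((2 + L) * (1 + L)))
count-3 L = begin
  3 * count (3 + L) 3                         ≡⟨ count-absorption (2 + L) 2 ⟩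
  2 * (3 + L) * count (2 + L) 2               ≡⟨ cong (2 * (3 + L) *_) (count-2 L) ⟩
  2 * (3 + L) * (2 * ((2 + L) * (1 + L)))     ≡⟨ collect L ⟩
  4 * ((3 + L) * ((2 + L) * (1 + L)))         ∎
  where
  open ≡-Reasoning
  collect : ∀ L → 2 * (3 + L) * (2 * ((2 + L) * (1 + L))) ≡ 4 * ((3 + L) * ((2 + L) * (1 + L)))
  collect = solve-∀

-- After the substitution a = 3 + b the difference of the two sides is a polynomial in b with
-- positive coefficients. The next two bounds are proved in the same way.
count-2< : ∀ {a} → 3 ≤ a → count (suc a) 2 < a ^ 3
count-2< (s≤s (s≤s (s≤s {n = b} _))) = begin-strict
  count (4 + b) 2                                              ≡⟨ count-2 (2 + b) ⟩
  2 * ((4 + b) * (3 + b))                                      <⟨ m<m+n _ z<s ⟩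
  2 * ((4 + b) * (3 + b)) + suc (2 + 13 * b + 7 * (b * b) + b * (b * b))  ≡⟨ expand b ⟩
  (3 + b) * ((3 + b) * ((3 + b) * 1))                          ∎
  where
  open ≤-Reasoning
  expand : ∀ b → 2 * ((4 + b) * (3 + b)) + suc (2 + 13 * b + 7 * (b * b) + b * (b * b))
                 ≡ (3 + b) * ((3 + b) * ((3 + b) * 1))
  expand = solve-∀

-- The count is 4 (a ^ 3 - a) / 3, which exceeds a ^ 3 for a ≥ 3; hence the factor 2.
count-3< : ∀ {a} → 3 ≤ a → count (suc a) 3 < 2 * a ^ 3
count-3< (s≤s (s≤s (s≤s {n = b} _))) = *-cancelˡ-< 3 _ _ (begin-strict
  3 * count (4 + b) 3                         ≡⟨ count-3 (1 + b) ⟩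
  4 * ((4 + b) * ((3 + b) * (2 + b)))         <⟨ m<m+n _ z<s ⟩
  4 * ((4 + b) * ((3 + b) * (2 + b))) + suc (65 + 58 * b + 18 * (b * b) + 2 * (b * (b * b)))
                                              ≡⟨ expand b ⟩
  3 * (2 * ((3 + b) * ((3 + b) * ((3 + b) * 1)))) ∎)
  where
  open ≤-Reasoning
  expand : ∀ b → 4 * ((4 + b) * ((3 + b) * (2 + b)))
                   + suc (65 + 58 * b + 18 * (b * b) + 2 * (b * (b * b)))
                 ≡ 3 * (2 * ((3 + b) * ((3 + b) * ((3 + b) * 1))))
  expand = solve-∀

count-4< : ∀ {a} → 3 ≤ a → count (suc a) 4 < a ^ 4
-- The factor 12 = 4 * 3 clears the denominators in `count-absorption` and `count-3`.
count-4< (s≤s (s≤s (s≤s {n = b} _))) = *-cancelˡ-< 12 _ _ (begin-strict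
  12 * count (4 + b) 4                        ≡⟨ assoc₁ (count (4 + b) 4) ⟩
  3 * (4 * count (4 + b) 4)                   ≡⟨ cong (3 *_) (count-absorption (3 + b) 3) ⟩
  3 * (2 * (4 + b) * count (3 + b) 3)         ≡⟨ assoc₂ b (count (3 + b) 3) ⟩
  2 * (4 + b) * (3 * count (3 + b) 3)         ≡⟨ cong (2 * (4 + b) *_) (count-3 b) ⟩
  2 * (4 + b) * (4 * ((3 + b) * ((2 + b) * (1 + b)))) <⟨ m<m+n _ z<s ⟩
  2 * (4 + b) * (4 * ((3 + b) * ((2 + b) * (1 + b))))
    + suc (779 + 896 * b + 368 * (b * b) + 64 * (b * (b * b)) + 4 * (b * (b * (b * b))))
                                              ≡⟨ expand b ⟩
  12 * ((3 + b) * ((3 + b) * ((3 + b) * ((3 + b) * 1)))) ∎)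
  where
  open ≤-Reasoning
  assoc₁ : ∀ q → 12 * q ≡ 3 * (4 * q)
  assoc₁ = solve-∀
  assoc₂ : ∀ b q → 3 * (2 * (4 + b) * q) ≡ 2 * (4 + b) * (3 * q)
  assoc₂ = solve-∀
  expand : ∀ b → 2 * (4 + b) * (4 * ((3 + b) * ((2 + b) * (1 + b))))
                   + suc (779 + 896 * b + 368 * (b * b) + 64 * (b * (b * b)) + 4 * (b * (b * (b * b))))
                 ≡ 12 * ((3 + b) * ((3 + b) * ((3 + b) * ((3 + b) * 1))))
  expand = solve-∀

-- By absorption, the step from 4 + r to 5 + r multiplies the count by at most 2 (a + 1) / (5 + r),
-- which is at most a.
count-≥4< : ∀ r {a} → 3 ≤ a → count (suc a) (4 + r) < a ^ (4 + r)
count-≥4< zero    3≤a = count-4< 3≤a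
count-≥4< (suc r) {a} 3≤a = *-cancelˡ-< (5 + r) _ _ (begin-strict
  (5 + r) * count (suc a) (5 + r)  ≡⟨ count-absorption a (4 + r) ⟩
  2 * suc a * count a (4 + r)      ≤⟨ *-monoʳ-≤ (2 * suc a) (count-mono a (4 + r)) ⟩
  2 * suc a * count (suc a) (4 + r) <⟨ *-monoʳ-< (2 * suc a) (count-≥4< r 3≤a) ⟩
  2 * suc a * a ^ (4 + r)          ≤⟨ *-monoˡ-≤ (a ^ (4 + r)) factor≤ ⟩
  (5 + r) * a * a ^ (4 + r)        ≡⟨ *-assoc (5 + r) a (a ^ (4 + r)) ⟩
  (5 + r) * a ^ (5 + r)            ∎)
  where
  open ≤-Reasoning
  expandˡ : ∀ a → 2 * suc a ≡ 2 + 2 * a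
  expandˡ = solve-∀
  expandʳ : ∀ r a → a + 2 * a + (2 + r) * a ≡ (5 + r) * a
  expandʳ = solve-∀
  factor≤ : 2 * suc a ≤ (5 + r) * a
  factor≤ = begin
    2 * suc a                  ≡⟨ expandˡ a ⟩
    2 + 2 * a                  ≤⟨ +-monoˡ-≤ (2 * a) (<⇒≤ 3≤a) ⟩
    a + 2 * a                  ≤⟨ m≤m+n (a + 2 * a) ((2 + r) * a) ⟩
    a + 2 * a + (2 + r) * a    ≡⟨ expandʳ r a ⟩
    (5 + r) * a                ∎

-- The number of greedy rounds

-- The left side consists of the first two terms of the binomial expansion of the right side.
bernoulli : ∀ e m → e ^ suc m + suc m * e ^ m ≤ suc e ^ suc m
bernoulli e zero    = ≤-reflexive (expand e)
  where
  expand : ∀ e → e * 1 + 1 * 1 ≡ suc e * 1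
  expand = solve-∀
bernoulli e (suc m) = begin
  e * (e * p) + suc (suc m) * (e * p)                      ≤⟨ m≤m+n _ (suc m * p) ⟩
  e * (e * p) + suc (suc m) * (e * p) + suc m * p          ≡⟨ expand e m p ⟩
  suc e * (e * p + suc m * p)                              ≤⟨ *-monoʳ-≤ (suc e) (bernoulli e m) ⟩
  suc e * suc e ^ suc m                                    ∎
  where
  open ≤-Reasoning
  p = e ^ m
  expand : ∀ e m p → e * (e * p) + suc (suc m) * (e * p) + suc m * p ≡ suc e * (e * p + suc m * p)
  expand = solve-∀

-- Bernoulli with m = e: the second term, suc e * e ^ e, is at least e ^ suc e.
2*e^D≤D^D : ∀ e → 2 * e ^ suc e ≤ suc e ^ suc e
2*e^D≤D^D e = ≤-trans (+-monoʳ-≤ (e ^ suc e)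
  (≤-trans (≤-reflexive (+-identityʳ _)) (m≤n+m (e ^ suc e) (e ^ e)))) (bernoulli e e)

^-comm : ∀ a m l → (a ^ m) ^ l ≡ (a ^ l) ^ m
^-comm a m l = trans (^-*-assoc a m l) (trans (cong (a ^_) (*-comm m l)) (≡-sym (^-*-assoc a l m)))

^-distribʳ-* : ∀ m l o → (m * l) ^ o ≡ m ^ o * l ^ o
^-distribʳ-* m l zero    = refl
^-distribʳ-* m l (suc o) rewrite ^-distribʳ-* m l o = swap m l (m ^ o) (l ^ o)
  where
  swap : ∀ m l p q → m * l * (p * q) ≡ m * p * (l * q)
  swap = solve-∀

-- With D = suc e: the first hypothesis says (D / e) ^ D ≥ 2 ^ (s / t), so that (D / e) ^ k is at
-- least (2 ^ k) ^ (s / (t D)) ≥ a ^ (r s / t), which exceeds N by the second.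
rounds-suffice : ∀ r a e k N s t .{{_ : NonZero e}} →
  2 ^ s * e ^ (t * suc e) ≤ suc e ^ (t * suc e) → N ^ t < a ^ (s * r) →
  a ^ (r * suc e) ≤ 2 ^ k → N * e ^ k < suc e ^ k
rounds-suffice r a e k N s t ratio N<a a≤2^k = ≰⇒> λ D^k≤ → <-irrefl refl (begin-strict
  (2 ^ s) ^ k            ≤⟨ *-cancelʳ-≤ ((2 ^ s) ^ k) (N ^ p) ((e ^ p) ^ k) {{m^n≢0 (e ^ p) k {{m^n≢0 e p}}}} (begin
    (2 ^ s) ^ k * (e ^ p) ^ k  ≡⟨ ^-distribʳ-* (2 ^ s) (e ^ p) k ⟨
    (2 ^ s * e ^ p) ^ k        ≤⟨ ^-monoˡ-≤ k ratio ⟩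
    (suc e ^ p) ^ k            ≡⟨ ^-comm (suc e) p k ⟩
    (suc e ^ k) ^ p            ≤⟨ ^-monoˡ-≤ p D^k≤ ⟩
    (N * e ^ k) ^ p            ≡⟨ ^-distribʳ-* N (e ^ k) p ⟩
    N ^ p * (e ^ k) ^ p        ≡⟨ cong (N ^ p *_) (^-comm e k p) ⟩
    N ^ p * (e ^ p) ^ k        ∎) ⟩
  N ^ p                  ≡⟨ ^-*-assoc N t (suc e) ⟨
  (N ^ t) ^ suc e        <⟨ ^-monoˡ-< (suc e) N<a ⟩
  (a ^ (s * r)) ^ suc e  ≡⟨ ^-*-assoc a (s * r) (suc e) ⟩
  a ^ (s * r * suc e)    ≡⟨ cong (a ^_) (rotate s r (suc e)) ⟩
  a ^ (r * suc e * s)    ≡⟨ ^-*-assoc a (r * suc e) s ⟨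
  (a ^ (r * suc e)) ^ s  ≤⟨ ^-monoˡ-≤ s a≤2^k ⟩
  (2 ^ k) ^ s            ≡⟨ ^-comm 2 k s ⟩
  (2 ^ s) ^ k            ∎)
  where
  open ≤-Reasoning
  p = t * suc e
  rotate : ∀ s r d → s * r * d ≡ r * d * s
  rotate = solve-∀

-- Write D = 2 ^ r. For r ≥ 4 the count is below a ^ r and (D / e) ^ D ≥ 2 is enough. For r = 2 and
-- r = 3 the count exceeds a ^ r; this is offset by the sharper (D / e) ^ D ≥ 2 ^ (3 / 2), which is
-- checked by computation for D = 4 and D = 8.
few-partials : ∀ {r a} → 2 ≤ r → ∀ e k → 3 ≤ a → 2 ^ r ≡ suc e → a ^ (r * 2 ^ r) ≤ 2 ^ k →
  count (suc a) r * e ^ k < suc e ^ k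
few-partials {1} (s≤s ())
few-partials {2} {a} _ e k 3≤a refl a≤2^k =
  rounds-suffice 2 a 3 k (count (suc a) 2) 3 2 (≤ᵇ⇒≤ _ _ tt) N²<a⁶ a≤2^k
  where
  N²<a⁶ : count (suc a) 2 ^ 2 < a ^ 6
  N²<a⁶ = <-≤-trans (^-monoˡ-< 2 (count-2< 3≤a)) (≤-reflexive (^-*-assoc a 3 2))
few-partials {3} {a} _ e k 3≤a refl a≤2^k =
  rounds-suffice 3 a 7 k (count (suc a) 3) 3 2 (≤ᵇ⇒≤ _ _ tt) N²<a⁹ a≤2^k
  where
  open ≤-Reasoning
  N²<a⁹ : count (suc a) 3 ^ 2 < a ^ 9
  N²<a⁹ = begin-strict
    count (suc a) 3 ^ 2          <⟨ ^-monoˡ-< 2 (count-3< 3≤a) ⟩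
    (2 * a ^ 3) ^ 2        ≡⟨ ^-distribʳ-* 2 (a ^ 3) 2 ⟩
    4 * (a ^ 3) ^ 2        ≡⟨ cong (4 *_) (^-*-assoc a 3 2) ⟩
    4 * a ^ 6              ≤⟨ *-monoˡ-≤ (a ^ 6) (≤-trans (≤ᵇ⇒≤ 4 27 tt) (^-monoˡ-≤ 3 3≤a)) ⟩
    a ^ 3 * a ^ 6    ≡⟨ ^-distribˡ-+-* a 3 6 ⟨
    a ^ 9                  ∎
few-partials {suc (suc (suc (suc r)))} {a} _ e k 3≤a D≡ a≤2^k =
  rounds-suffice (4 + r) a e k N 1 1 {{e≢0}} ratio N<a (subst (λ D → a ^ ((4 + r) * D) ≤ 2 ^ k) D≡ a≤2^k)
  where
  N = count (suc a) (4 + r)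
  e≢0 : NonZero e
  e≢0 = >-nonZero (s≤s⁻¹ (≤-trans (^-monoʳ-≤ 2 {1} {4 + r} (s≤s z≤n)) (≤-reflexive D≡)))
  ratio : 2 ^ 1 * e ^ (1 * suc e) ≤ suc e ^ (1 * suc e)
  ratio = subst (λ p → 2 * e ^ p ≤ suc e ^ p) (≡-sym (*-identityˡ (suc e))) (2*e^D≤D^D e)
  N<a : N ^ 1 < a ^ (1 * (4 + r))
  N<a = subst₂ (λ M q → M < a ^ q) (≡-sym (*-identityʳ N)) (≡-sym (*-identityˡ (4 + r)))
    (count-≥4< r 3≤a)

-- Dyadic brackets and the ceiling bound

-- Thus j + 1 is the ceiling of log A. Applied to `c` it gives the word length, and applied to a ^
-- (r * 2 ^ r) the number of rounds.
dyadic-bracket : ∀ {A} → 2 ≤ A → ∃[ j ] (2 ^ j < A × A ≤ 2 ^ suc j)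
dyadic-bracket {2} _ = 0 , ≤-refl , ≤-refl
dyadic-bracket {suc A@(suc (suc _))} _ = extend (dyadic-bracket {A} (s≤s (s≤s z≤n)))
  where
  open ≤-Reasoning
  extend : ∃[ j ] (2 ^ j < A × A ≤ 2 ^ suc j) → ∃[ j ] (2 ^ j < suc A × suc A ≤ 2 ^ suc j)
  extend (j , lower , upper) with suc A ≤? 2 ^ suc j
  ... | yes fits  = j , m<n⇒m<1+n lower , fits
  ... | no  large = suc j , ≰⇒> large , (begin
    1 + A                        ≤⟨ +-mono-≤ (m^n>0 2 (suc j)) upper ⟩
    2 ^ suc j + 2 ^ suc j        ≡⟨ cong (2 ^ suc j +_) (+-identityʳ (2 ^ suc j)) ⟨
    2 ^ (2 + j)                  ∎)
dyadic-bracket {1} (s≤s ())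

8≤r*2^r : ∀ {r} → 2 ≤ r → 8 ≤ r * 2 ^ r
8≤r*2^r 2≤r = *-mono-≤ 2≤r (^-monoʳ-≤ 2 2≤r)

-- Since a / b ≥ 1, its powers do not decrease, so it suffices to compare at exponent 8, the value
-- of r * 2 ^ r at r = 2.
ltMulLogLog : ∀ {j j₀ m c} a b → 0 < b → b ≤ a → j ≤ j₀ → 8 ≤ m →
  2 ^ j₀ * b ^ 8 < a ^ 8 → 2 ^ a < c ^ b → LtMulLogLog j m c
ltMulLogLog {j} {j₀} a b 0<b b≤a j≤j₀ 8≤m small 2^a<c^b
  with m≤n⇒∃[o]m+o≡n 8≤m
... | o , refl = a , b , 0<b , (begin-strict
  2 ^ j * b ^ (8 + o)          ≡⟨ cong (2 ^ j *_) (^-distribˡ-+-* b 8 o) ⟩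
  2 ^ j * (b ^ 8 * b ^ o)      ≡⟨ *-assoc (2 ^ j) (b ^ 8) (b ^ o) ⟨
  2 ^ j * b ^ 8 * b ^ o        ≤⟨ *-mono-≤ (*-monoˡ-≤ (b ^ 8) (^-monoʳ-≤ 2 j≤j₀)) (^-monoˡ-≤ o b≤a) ⟩
  2 ^ j₀ * b ^ 8 * a ^ o       <⟨ *-monoˡ-< (a ^ o) {{m^n≢0 a o {{>-nonZero (<-≤-trans 0<b b≤a)}}}} small ⟩
  a ^ 8 * a ^ o                ≡⟨ ^-distribˡ-+-* a 8 o ⟨
  a ^ (8 + o)                  ∎) , 2^a<c^b
  where open ≤-Reasoning

ltMulLogLog-integer : ∀ j m {c} a → 2 ^ j < a ^ m → 2 ^ a < c → LtMulLogLog j m c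
ltMulLogLog-integer j m {c} a 2^j<a^m 2^a<c = a , 1 , ≤-refl ,
  subst (_< a ^ m) (≡-sym (trans (cong (2 ^ j *_) (^-zeroˡ m)) (*-identityʳ (2 ^ j)))) 2^j<a^m ,
  subst (2 ^ a <_) (≡-sym (*-identityʳ c)) 2^a<c

leCeilBound-c≤8 : ∀ {r c} → 2 ≤ r → 2 < c → c ≤ 8 → LeCeilBound c r c
leCeilBound-c≤8 {r} {c} 2≤r 2<c c≤8 with c ≤? 4
-- For c = 3 and c = 4: 3 / 2 < log c because 2 ^ 3 < 3 ^ 2, and (3 / 2) ^ 8 > 2 ^ 3 with c - 1 ≤ 3.
... | yes c≤4 = inj₂ (ltMulLogLog {j₀ = 3} 3 2 (s≤s z≤n) (s≤s (s≤s z≤n)) (∸-monoˡ-≤ 1 c≤4) (8≤r*2^r 2≤r)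
  (≤ᵇ⇒≤ _ _ tt) (^-monoˡ-≤ 2 2<c))
-- For 5 ≤ c ≤ 8: 2 < log c, and 2 ^ 8 > 2 ^ 7 with c - 1 ≤ 7.
... | no  c≰4 = inj₂ (ltMulLogLog {j₀ = 7} 2 1 (s≤s z≤n) (s≤s z≤n) (∸-monoˡ-≤ 1 c≤8) (8≤r*2^r 2≤r)
  (≤ᵇ⇒≤ _ _ tt) (≤-trans (≰⇒> c≰4) (≤-reflexive (≡-sym (*-identityʳ c)))))

-- Here log log c > log a ≥ 1, so the bound is at least r * 2 ^ r, hence at least `c`.
leCeilBound-c≤2^r : ∀ {r c} a → 2 ≤ a → 2 ^ a < c → 1 ≤ r → c ≤ 2 ^ r → LeCeilBound c r c
leCeilBound-c≤2^r {r} {suc c} a 2≤a 2^a<c 1≤r c≤2^r =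
  inj₂ (ltMulLogLog-integer c (r * 2 ^ r) a (begin-strict
  2 ^ c            <⟨ ^-monoʳ-< 2 ≤-refl c≤2^r ⟩
  2 ^ (2 ^ r)      ≤⟨ ^-monoˡ-≤ (2 ^ r) 2≤a ⟩
  a ^ (2 ^ r)      ≤⟨ ^-monoʳ-≤ a {{>-nonZero (<-≤-trans z<s 2≤a)}} (m≤n*m (2 ^ r) r {{>-nonZero 1≤r}}) ⟩
  a ^ (r * 2 ^ r)  ∎) 2^a<c)
  where open ≤-Reasoning

-- Assembling the bound on the number of colours

-- With A = a ^ (r * 2 ^ r), take k to be the ceiling of log A. Then A ≤ 2 ^ k makes k rounds
-- enough, while 2 ^ (k - 1) < A and a < log c put k - 1 below r * 2 ^ r * log log c.
universal-bound : ∀ {c r a} → 2 ≤ r → 3 ≤ a → 2 ^ a < c → r ≤ suc a →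
  ∃[ k ] Universal r (suc a) k × LeCeilBound k r c
universal-bound {c} {r} {a} 2≤r 3≤a 2^a<c r≤1+a =
  bound (dyadic-bracket 2≤A) (m≤n⇒∃[o]m+o≡n (m^n>0 2 r))
  where
  open ≤-Reasoning
  2≤A : 2 ≤ a ^ (r * 2 ^ r)
  2≤A = begin
    2                ≤⟨ <⇒≤ 3≤a ⟩
    a                ≡⟨ ^-identityʳ a ⟨
    a ^ 1            ≤⟨ ^-monoʳ-≤ a {{>-nonZero (<-≤-trans z<s 3≤a)}} (≤-trans (s≤s z≤n) (8≤r*2^r 2≤r)) ⟩
    a ^ (r * 2 ^ r)  ∎
  bound : ∃[ j ] (2 ^ j < a ^ (r * 2 ^ r) × a ^ (r * 2 ^ r) ≤ 2 ^ suc j) → ∃[ e ] suc e ≡ 2 ^ r →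
    ∃[ k ] Universal r (suc a) k × LeCeilBound k r c
  bound (j , lower , upper) (e , D≡) = suc j ,
    universal-greedy r e (suc j) (suc a) (≡-sym D≡) r≤1+a enough ,
    inj₂ (ltMulLogLog-integer j (r * 2 ^ r) a lower 2^a<c)
    where
    enough : count (suc a) r * e ^ suc j < suc e ^ suc j
    enough = few-partials 2≤r e (suc j) 3≤a (≡-sym D≡) upper

theorem1p1 : (G H : Graph) (φ : V H → V G) → IsHom H G φ →
    (r : ℕ) → 1 ≤ r → (∀ v → ∣ imageNbhd H G φ v ∣ ≤ r) →
    (c : ℕ) → IsChromaticNumber G c → 2 < c →
    ∃ λ k → Colourable H k × LeCeilBound k r c
theorem1p1 G H φ hom r 1≤r deg c (colouring@(ψ , proper) , _) 2<c =
  cases (m≤n⇒m<n∨m≡n 1≤r) (dyadic-bracket (<⇒≤ 2<c))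
  where
  Bounded : Set
  Bounded = ∃ λ k → Colourable H k × LeCeilBound k r c

  pullback : Colourable H c
  pullback = (λ v → ψ (φ v)) , λ u v uv → proper (φ u) (φ v) (hom u v uv)

  colour : ∀ {L k} → c ≤ 2 ^ suc L → Universal r (suc L) k → Colourable H k
  colour = universal⇒colourable {G} {H} φ hom deg colouring

  large : 2 ≤ r → ∀ {a} → 3 ≤ a → 2 ^ a < c → c ≤ 2 ^ suc a → Dec (r ≤ suc a) → Bounded
  large 2≤r {a} 3≤a lower upper (no r≰1+a) = c , pullback ,
    leCeilBound-c≤2^r a (<⇒≤ 3≤a) lower 1≤r (≤-trans upper (^-monoʳ-≤ 2 (<⇒≤ (≰⇒> r≰1+a))))
  large 2≤r 3≤a lower upper (yes r≤1+a) =
    let k , family , bound = universal-bound 2≤r 3≤a lower r≤1+a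
    in k , colour upper family , bound

  medium : 2 ≤ r → ∀ {a} → 2 ^ a < c → c ≤ 2 ^ suc a → Dec (3 ≤ a) → Bounded
  medium 2≤r {a} lower upper (yes 3≤a) = large 2≤r 3≤a lower upper (r ≤? suc a)
  medium 2≤r lower upper (no a≱3) = c , pullback ,
    leCeilBound-c≤8 2≤r 2<c (≤-trans upper (^-monoʳ-≤ 2 (≰⇒> a≱3)))

  cases : 2 ≤ r ⊎ 1 ≡ r → ∃[ a ] (2 ^ a < c × c ≤ 2 ^ suc a) → Bounded
  cases (inj₁ 2≤r) (a , lower , upper) = medium 2≤r lower upper (3 ≤? a)
  cases (inj₂ 1≡r) (a , lower , upper) = 2 ,
    colour upper (subst (λ s → Universal s (suc a) 2) 1≡r (universal-1 (suc a))) ,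
    subst (λ s → LeCeilBound 2 s c) 1≡r
      -- The claim is 1 < 2 log log c. The fraction 3 / 2 works: its square exceeds 2, and 3 / 2 <
      -- log 3 ≤ log c.
      (inj₂ (3 , 2 , s≤s z≤n , ≤-refl , ^-monoˡ-≤ 2 2<c))
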